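{- Let $m,k$ be integers with $0 < k \le \lfloor\frac{m-1}{2}\rfloor$. Then 1. $\mathcal{G}(\mathcal{P}_{1,1}(m,k)) \in \{0,1,2\}$; 2. $\mathcal{G}(\mathcal{P}_{0,1}(m,k)) \in \{0,1\}$ and $\mathcal{G}(\mathcal{P}_{1,0}(m,k)) \in \{0,1\}$.
   Context: Toggle: Let $G$ be a finite simple graph, with $N[v]$ the closed neighborhood of $v$. A position $\{G,V_0\}$ consists of $G$ and a set $V_0\subseteq V(G)$ of vertices of weight $0$; all other vertices have weight $1$. Let $\sigma(v)$ be the sum of the weights of the vertices in $N[v]$. A legal move consists of choosing a vertex $v$ of weight $1$ and switching the weight ($0\leftrightarrow 1$) of every vertex of $N[v]$; it is allowed only if $\sigma(v)$ after the switch is strictly smaller than $\sigma(v)$ before it. Two players alternate legal moves; a player with no legal move loses. Nimbers: $\mathcal{G}(\mathcal{S})=\mathrm{mex}\{\mathcal{G}(\mathcal{S}') : \mathcal{S}' \text{ reachable from } \mathcal{S} \text{ by one legal move}\}$, where $\mathrm{mex}(T)$ is the least nonnegative integer not in the finite set $T$ (so $\mathrm{mex}(\emptyset)=0$). The generalized Petersen graph $P(m,k)$ has inner vertices $v_{0,1},\dots,v_{0,m}$ and outer vertices $v_{1,1},\dots,v_{1,m}$ (second indices modulo $m$), with edges $v_{1,i}v_{1,i+1}$, $v_{0,i}v_{0,i+k}$ and $v_{0,i}v_{1,i}$ for all $i$. Positions on $P(m,k)$: $\mathcal{P}_{0,1}(m,k)$ has all inner vertices of weight $0$ and all outer vertices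 of weight $1$; $\mathcal{P}_{1,0}(m,k)$ has all inner vertices of weight $1$ and all outer vertices of weight $0$; $\mathcal{P}_{1,1}(m,k)$ has all vertices of weight $1$. -}

module Defs where

open import Data.Bool.Base using (Bool; true; false; if_then_else_; not)
open import Data.Fin.Base using (Fin; toℕ; fromℕ; fromℕ<; inject)
import Data.Fin.Properties as Fin
open import Data.List.Base using (List; []; _∷_; _++_; map; filter; allFin)
open import Data.List.Extrema.Nat using (max; xs≤max)
open import Data.List.Membership.DecPropositional using () renaming (_∈?_ to member?)
open import Data.List.Membership.Propositional using (_∈_; _∉_; mapWith∈)
open import Data.List.Membership.Propositional.Properties
open import Data.List.Relation.Unary.All as All using ()
open import Data.List.Relation.Unary.Unique.Propositional using (Unique)
import Data.List.Relation.Unary.Unique.Propositional.Properties as Unique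
open import Data.Nat.Base
open import Data.Nat.DivMod using (_mod_; _%_; m%n<n; m<n⇒m%n≡m; m≤n⇒[n∸m]%m≡n%m)
open import Data.Nat.Induction using (<-wellFounded)
open import Data.Nat.ListAction using (sum)
open import Data.Nat.Properties
open import Algebra.Properties.CommutativeSemigroup +-commutativeSemigroup using (interchange; x∙yz≈y∙xz)
open import Data.Product.Base using (∃; _×_; _,_; proj₁; proj₂)
open import Data.Sum.Base using (_⊎_; inj₁; inj₂)
open import Function.Base using (_∘_; id)
open import Induction.WellFounded using (WellFounded; module All; module FixPoint; module Subrelation)
open import Level using (0ℓ)
open import Relation.Binary.Construct.Closure.Symmetric using (SymClosure; fwd; bwd; symmetric)
import Relation.Binary.Construct.On as On
open import Relation.Binary.Core using (Rel)
open import Relation.Binary.Definitions using (Decidable; DecidableEquality; Irreflexive; Symmetric)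
open import Relation.Binary.PropositionalEquality
open import Relation.Nullary using (¬_; Dec; yes; no; does; contradiction)
import Relation.Unary as Unary
open import Relation.Nullary.Decidable using (map′; dec-false; _⊎-dec_; _×-dec_)

IsMex : List ℕ → ℕ → Set
IsMex T n = n ∉ T × (∀ {m} → m < n → m ∈ T)

-- 1 + max T is not in T, so a least excluded value exists below 2 + max T.
mex-exists : ∀ T → ∃ (IsMex T)
mex-exists T
  with i , i∉T , below ← Fin.¬∀⟶∃¬-smallest (2 + max 0 T) (λ i → toℕ i ∈ T)
         (λ i → member? _≟_ (toℕ i) T)
         (λ all∈ → <-irrefl refl (All.lookup (xs≤max 0 T)
            (subst (_∈ T) (Fin.toℕ-fromℕ (1 + max 0 T)) (all∈ (fromℕ _)))))
  = toℕ i , i∉T , λ m<i →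
      subst (_∈ T) (trans (Fin.toℕ-inject (fromℕ< m<i)) (Fin.toℕ-fromℕ< m<i))
        (below (fromℕ< m<i))

mex : List ℕ → ℕ
mex T = proj₁ (mex-exists T)

record SimpleGraph : Set₁ where
  field
    V         : Set
    vertices  : List V
    complete  : ∀ v → v ∈ vertices
    unique    : Unique vertices
    _≟ⱽ_      : DecidableEquality V
    Adj       : Rel V 0ℓ
    adj?      : Decidable Adj
    adj-sym   : Symmetric Adj
    adj-irrefl : Irreflexive _≡_ Adj

  _∈N[_] : V → V → Set
  u ∈N[ v ] = u ≡ v ⊎ Adj v u

  _∈N?[_] : Decidable _∈N[_]
  u ∈N?[ v ] = (u ≟ⱽ v) ⊎-dec adj? v u

  N[_] : V → List V
  N[ v ] = filter (_∈N?[ v ]) vertices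

sum-exchange : ∀ {A : Set} {Q : A → Set} (Q? : Unary.Decidable Q) {f g : A → ℕ} →
               (∀ {x} → ¬ Q x → f x ≡ g x) → ∀ xs →
               sum (map f (filter Q? xs)) + sum (map g xs)
             ≡ sum (map g (filter Q? xs)) + sum (map f xs)
sum-exchange Q? agree [] = refl
sum-exchange Q? {f} {g} agree (x ∷ xs) with Q? x
... | yes _ = begin
  (f x + fN) + (g x + gT)  ≡⟨ interchange (f x) fN (g x) gT ⟩
  (f x + g x) + (fN + gT)  ≡⟨ cong₂ _+_ (+-comm (f x) (g x)) (sum-exchange Q? agree xs) ⟩
  (g x + f x) + (gN + fT)  ≡⟨ interchange (g x) (f x) gN fT ⟩
  (g x + gN) + (f x + fT)  ∎
  where
  open ≡-Reasoning
  fN = sum (map f (filter Q? xs))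
  gN = sum (map g (filter Q? xs))
  fT = sum (map f xs)
  gT = sum (map g xs)
... | no ¬Qx = begin
  fN + (g x + gT)  ≡⟨ x∙yz≈y∙xz fN (g x) gT ⟩
  g x + (fN + gT)  ≡⟨ cong₂ _+_ (sym (agree ¬Qx)) (sum-exchange Q? agree xs) ⟩
  f x + (gN + fT)  ≡⟨ x∙yz≈y∙xz (f x) gN fT ⟩
  gN + (f x + fT)  ∎
  where
  open ≡-Reasoning
  fN = sum (map f (filter Q? xs))
  gN = sum (map g (filter Q? xs))
  fT = sum (map f xs)
  gT = sum (map g xs)

module Toggle (G : SimpleGraph) where
  open SimpleGraph G

  -- A position {G, V₀} is given by the characteristic function of V₀:
  -- true marks the vertices of weight 0.
  Position : Set
  Position = V → Bool

  weight : Position → V → ℕ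
  weight V₀ v = if V₀ v then 0 else 1

  σ : Position → V → ℕ
  σ V₀ v = sum (map (weight V₀) N[ v ])

  toggle : Position → V → Position
  toggle V₀ v u = if does (u ∈N?[ v ]) then not (V₀ u) else V₀ u

  Legal : Position → V → Set
  Legal V₀ v = weight V₀ v ≡ 1 × σ (toggle V₀ v) v < σ V₀ v

  legal? : Decidable Legal
  legal? V₀ v = (weight V₀ v ≟ 1) ×-dec (σ (toggle V₀ v) v <? σ V₀ v)

  options : Position → List Position
  options V₀ = map (toggle V₀) (filter (legal? V₀) vertices)

  -- The game terminates: a legal move changes weights only inside N[ v ],
  -- so the total weight drops by as much as σ v does.
  total : Position → ℕ
  total V₀ = sum (map (weight V₀) vertices)

  toggle-outside : ∀ V₀ {v u} → ¬ (u ∈N[ v ]) → weight V₀ u ≡ weight (toggle V₀ v) u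
  toggle-outside V₀ {v} {u} u∉ rewrite dec-false (u ∈N?[ v ]) u∉ = refl

  legal⇒total-decreases : ∀ {V₀ v} → Legal V₀ v → total (toggle V₀ v) < total V₀
  legal⇒total-decreases {V₀} {v} (_ , σ<) with total (toggle V₀ v) <? total V₀
  ... | yes lt = lt
  ... | no ≮   = contradiction
    (sym (sum-exchange (_∈N?[ v ]) (toggle-outside V₀) vertices))
    (<⇒≢ (+-mono-<-≤ σ< (≮⇒≥ ≮)))

  _≺_ : Rel Position 0ℓ
  V₁ ≺ V₀ = V₁ ∈ options V₀

  ≺⇒total< : ∀ {V₁ V₀} → V₁ ≺ V₀ → total V₁ < total V₀
  ≺⇒total< {V₀ = V₀} ≺ with _ , v∈ , refl ← ∈-map⁻ (toggle V₀) ≺ =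
    legal⇒total-decreases (proj₂ (∈-filter⁻ (legal? V₀) {xs = vertices} v∈))

  ≺-wellFounded : WellFounded _≺_
  ≺-wellFounded = Subrelation.wellFounded ≺⇒total< (On.wellFounded total <-wellFounded)

  -- 𝒢 is defined by well-founded recursion; 𝒢-unfold is its defining equation.
  step : ∀ V₀ → (∀ {V₁} → V₁ ≺ V₀ → ℕ) → ℕ
  step V₀ rec = mex (mapWith∈ (options V₀) rec)

  𝒢 : Position → ℕ
  𝒢 = All.wfRec ≺-wellFounded 0ℓ (λ _ → ℕ) step

  𝒢-unfold : ∀ V₀ → 𝒢 V₀ ≡ mex (map 𝒢 (options V₀))
  𝒢-unfold V₀ = trans
    (FixPoint.unfold-wfRec ≺-wellFounded (λ _ → ℕ) step
      (λ V eq → cong mex (mapWith∈-cong (options V) _ _ eq)))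
    (cong mex (mapWith∈≗map 𝒢 (options V₀)))

-- Indices modulo m are represented by 0, …, m - 1.
_⊕_ : ∀ {m} → Fin m → ℕ → Fin m
_⊕_ {m} i k = (toℕ i + k) mod m
  where instance _ = Fin.nonZeroIndex i

data Vertex (m : ℕ) : Set where
  inner outer : Fin m → Vertex m

data Edge {m : ℕ} (k : ℕ) : Rel (Vertex m) 0ℓ where
  outerEdge : ∀ i → Edge k (outer i) (outer (i ⊕ 1))
  innerEdge : ∀ i → Edge k (inner i) (inner (i ⊕ k))
  spoke     : ∀ i → Edge k (inner i) (outer i)

⊕-fixpoint-free : ∀ {m k} (i : Fin m) → 0 < k → k < m → i ≢ i ⊕ k
⊕-fixpoint-free {m@(suc _)} {k} i 0<k k<m i≡ = absurd (toℕ i + k <? m)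
  where
  open ≡-Reasoning
  eq : toℕ i ≡ (toℕ i + k) % m
  eq = trans (cong toℕ i≡) (Fin.toℕ-fromℕ< (m%n<n (toℕ i + k) m))
  absurd : ¬ Dec (toℕ i + k < m)
  absurd (yes lt) = <⇒≢ (m<m+n (toℕ i) 0<k) (trans eq (m<n⇒m%n≡m lt))
  absurd (no ≮) = <⇒≢ k<m (+-cancelˡ-≡ (toℕ i) k m (begin
    toℕ i + k            ≡⟨ m∸n+n≡m m≤ ⟨
    toℕ i + k ∸ m + m    ≡⟨ cong (_+ m) small ⟨
    toℕ i + m            ∎))
    where
    m≤ : m ≤ toℕ i + k
    m≤ = ≮⇒≥ ≮
    small : toℕ i ≡ toℕ i + k ∸ m
    small = trans eq (trans (sym (m≤n⇒[n∸m]%m≡n%m m≤))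
      (m<n⇒m%n≡m (+-cancelʳ-< m _ _
        (subst (_< m + m) (sym (m∸n+n≡m m≤)) (+-mono-< (Fin.toℕ<n i) k<m)))))

edge? : ∀ {m} k → Decidable (Edge {m} k)
edge? k (inner i) (inner j) = map′ (λ { refl → innerEdge i }) (λ { (innerEdge .i) → refl }) (j Fin.≟ i ⊕ k)
edge? k (inner i) (outer j) = map′ (λ { refl → spoke i }) (λ { (spoke .i) → refl }) (j Fin.≟ i)
edge? k (outer i) (inner j) = no λ ()
edge? k (outer i) (outer j) = map′ (λ { refl → outerEdge i }) (λ { (outerEdge .i) → refl }) (j Fin.≟ i ⊕ 1)

inner-injective : ∀ {m} {i j : Fin m} → inner i ≡ inner j → i ≡ j
inner-injective refl = refl

outer-injective : ∀ {m} {i j : Fin m} → outer i ≡ outer j → i ≡ j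
outer-injective refl = refl

edge⇒≢ : ∀ {m k} → 0 < k → k ≤ ⌊ m ∸ 1 /2⌋ → ∀ {x y : Vertex m} → Edge k x y → x ≢ y
edge⇒≢ {suc n} 0<k k≤ e = distinct e
  where
  k<m = s≤s (≤-trans k≤ (⌊n/2⌋≤n n))
  distinct : ∀ {x y} → Edge _ x y → x ≢ y
  distinct (outerEdge i) = ⊕-fixpoint-free i z<s (≤-<-trans 0<k k<m) ∘ outer-injective
  distinct (innerEdge i) = ⊕-fixpoint-free i 0<k k<m ∘ inner-injective
  distinct (spoke i) ()
edge⇒≢ {zero} 0<k k≤ _ = contradiction (≤-trans 0<k k≤) λ ()

_≟ᵛ_ : ∀ {m} → DecidableEquality (Vertex m)
inner i ≟ᵛ inner j = map′ (cong inner) inner-injective (i Fin.≟ j)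
inner i ≟ᵛ outer j = no λ ()
outer i ≟ᵛ inner j = no λ ()
outer i ≟ᵛ outer j = map′ (cong outer) outer-injective (i Fin.≟ j)

-- The bounds on k rule out loops.
Petersen : ∀ m k → 0 < k → k ≤ ⌊ m ∸ 1 /2⌋ → SimpleGraph
Petersen m k 0<k k≤ = record
  { V          = Vertex m
  ; vertices   = map inner (allFin m) ++ map outer (allFin m)
  ; complete   = λ where
      (inner i) → ∈-++⁺ˡ (∈-map⁺ inner (∈-allFin i))
      (outer i) → ∈-++⁺ʳ _ (∈-map⁺ outer (∈-allFin i))
  ; unique     = Unique.++⁺ (Unique.map⁺ inner-injective (Unique.allFin⁺ m))
                            (Unique.map⁺ outer-injective (Unique.allFin⁺ m))
                            disjoint
  ; _≟ⱽ_       = _≟ᵛ_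
  ; Adj        = SymClosure (Edge k)
  ; adj?       = λ x y → map′ (λ { (inj₁ e) → fwd e ; (inj₂ e) → bwd e })
                              (λ { (fwd e) → inj₁ e ; (bwd e) → inj₂ e })
                              (edge? k x y ⊎-dec edge? k y x)
  ; adj-sym    = symmetric (Edge k)
  ; adj-irrefl = λ { eq (fwd e) → edge⇒≢ 0<k k≤ e eq
                   ; eq (bwd e) → edge⇒≢ 0<k k≤ e (sym eq) }
  }
  where
  disjoint : ∀ {v} → ¬ (v ∈ map inner (allFin m) × v ∈ map outer (allFin m))
  disjoint (v∈ , v∈′) with ∈-map⁻ inner v∈ | ∈-map⁻ outer v∈′
  ... | _ , _ , refl | _ , _ , ()

module _ (m k : ℕ) (0<k : 0 < k) (k≤ : k ≤ ⌊ m ∸ 1 /2⌋) where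
  open Toggle (Petersen m k 0<k k≤)

  𝒫₀₁ : Position
  𝒫₀₁ (inner _) = true
  𝒫₀₁ (outer _) = false

  𝒫₁₀ : Position
  𝒫₁₀ (inner _) = false
  𝒫₁₀ (outer _) = true

  𝒫₁₁ : Position
  𝒫₁₁ _ = false

{-# OPTIONS --safe #-}
-- Grundy values are invariant under graph automorphisms. The rotations of
-- P(m,k) preserve each of the three positions and act transitively on the inner
-- and on the outer vertices, so the options of a position take at most one
-- Grundy value per orbit of playable vertices: two for 𝒫₁₁, and one for 𝒫₀₁ and
-- 𝒫₁₀, in which only the vertices of weight 1 can be played. The mex of a set
-- with at most n elements is at most n.
module Submission where

open import Defs
open import Data.Bool.Base using (if_then_else_; not)
open import Data.Fin.Base as Fin using (Fin; toℕ)
import Data.Fin.Properties as Fin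
open import Data.List.Base using (List; _∷_; []; length; lookup; map; upTo)
open import Data.List.Membership.Propositional using (_∈_)
open import Data.List.Membership.Propositional.Properties
  using (∈-filter⁺; ∈-filter⁻; ∈-map⁺; ∈-map⁻; ∈-upTo⁺)
open import Data.List.Membership.Propositional.Properties.WithK using (unique∧set⇒bag)
open import Data.List.Properties using (map-cong; map-∘)
open import Data.List.Relation.Binary.BagAndSetEquality using (∼bag⇒↭)
open import Data.List.Relation.Binary.Permutation.Propositional using (_↭_)
import Data.List.Relation.Binary.Permutation.Propositional.Properties as ↭
open import Data.List.Relation.Binary.Subset.Propositional using (_⊆_)
open import Data.List.Relation.Unary.Any using (here; there; index)
open import Data.List.Relation.Unary.Any.Properties using (lookup-index)
import Data.List.Relation.Unary.Unique.Propositional.Properties as Unique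
open import Data.Nat.Base
open import Data.Nat.DivMod using (_%_; %-distribˡ-+; [m+n]%n≡m%n; m%n%n≡m%n; m%n<n; m<n⇒m%n≡m)
open import Data.Nat.ListAction using (sum)
open import Data.Nat.ListAction.Properties using (sum-↭)
open import Data.Nat.Properties
open import Data.Product.Base using (_×_; _,_; proj₁; proj₂; ∃-syntax)
open import Data.Sum.Base using () renaming (map to ⊎-map)
open import Function.Base using (_∘_)
open import Function.Bundles using (_↔_; mk↔ₛ′; mk⇔; module Inverse; module Injection)
open import Function.Properties.Inverse using (↔-sym; ↔⇒↣)
open import Induction.WellFounded using (Acc; acc)
open import Relation.Binary.Construct.Closure.Symmetric using (gmap)
open import Relation.Binary.Definitions using (tri<; tri≈; tri>)
open import Relation.Binary.PropositionalEquality
open import Relation.Nullary using (contradiction; yes; no)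
open import Relation.Nullary.Decidable using (does-⇔)

-- Mex of finite sets given as lists

-- Pigeonhole: each number below `m` occupies a position in `L`, and no two can share one. The
-- separate list `L` matters because `T`, the values of all options, repeats many of them.
IsMex⇒≤length : ∀ {T m} L → T ⊆ L → IsMex T m → m ≤ length L
IsMex⇒≤length {T} {m} L T⊆L (_ , below) with m ≤? length L
... | yes m≤ = m≤
... | no m≰ = contradiction (Fin.pigeonhole (≰⇒> m≰) (index ∘ ∈L)) λ (i , j , i<j , eq) →
  <⇒≢ i<j (begin
    toℕ i                      ≡⟨ lookup-index (∈L i) ⟩
    lookup L (index (∈L i))    ≡⟨ cong (lookup L) eq ⟩
    lookup L (index (∈L j))    ≡⟨ lookup-index (∈L j) ⟨
    toℕ j                      ∎)
  where
  open ≡-Reasoning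
  ∈L : (i : Fin m) → toℕ i ∈ L
  ∈L i = T⊆L (below (Fin.toℕ<n i))

-- The smaller of two distinct mexes would lie in the other list, hence in its own.
IsMex-unique : ∀ {S T m n} → S ⊆ T → T ⊆ S → IsMex S m → IsMex T n → m ≡ n
IsMex-unique {m = m} {n} S⊆T T⊆S (m∉S , below-m) (n∉T , below-n) with <-cmp m n
... | tri< m<n _ _ = contradiction (T⊆S (below-n m<n)) m∉S
... | tri≈ _ m≡n _ = m≡n
... | tri> _ _ n<m = contradiction (S⊆T (below-m n<m)) n∉T

module _ {A B : Set} {f : A → B} {xs : List A} where

  map-⊆⁺ : ∀ {zs} → (∀ {x} → x ∈ xs → f x ∈ zs) → map f xs ⊆ zs
  map-⊆⁺ f∈ y∈ with _ , x∈ , refl ← ∈-map⁻ f y∈ = f∈ x∈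

  map-⊆-map⁺ : ∀ {ys} → (∀ {x} → x ∈ xs → ∃[ y ] y ∈ ys × f x ≡ f y) → map f xs ⊆ map f ys
  map-⊆-map⁺ {ys} match = map-⊆⁺ λ x∈ → let _ , y∈ , fx≡fy = match x∈ in
    subst (_∈ map f ys) (sym fx≡fy) (∈-map⁺ f y∈)

-- Automorphisms and the moves of the game

-- Adjacency is preserved in both directions by definition, so that `inverse` merely swaps fields.
record Automorphism (G : SimpleGraph) : Set where
  open SimpleGraph G
  field
    bijection : V ↔ V
  open Inverse bijection public using (to; from; strictlyInverseˡ; strictlyInverseʳ)
  field
    to-adj   : ∀ {u v} → Adj u v → Adj (to u) (to v)
    from-adj : ∀ {u v} → Adj u v → Adj (from u) (from v)

inverse : ∀ {G} → Automorphism G → Automorphism G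
inverse α = record
  { bijection = ↔-sym bijection
  ; to-adj    = from-adj
  ; from-adj  = to-adj
  }
  where open Automorphism α

module _ (G : SimpleGraph) where
  open SimpleGraph G
  open Toggle G

  module _ (α : Automorphism G) where
    open Automorphism α

    ∈N-to : ∀ {u v} → u ∈N[ v ] → to u ∈N[ to v ]
    ∈N-to = ⊎-map (cong to) to-adj

    ∈N-to⁻ : ∀ {u v} → to u ∈N[ to v ] → u ∈N[ v ]
    ∈N-to⁻ {u} {v} = subst₂ _∈N[_] (strictlyInverseʳ u) (strictlyInverseʳ v)
                     ∘ ⊎-map (cong from) from-adj

    -- Both lists are duplicate-free and have the same members. Only a permutation can be expected,
    -- since an automorphism may disturb the order of `vertices`.
    N-to : ∀ v → map to N[ v ] ↭ N[ to v ]
    N-to v = ∼bag⇒↭ (unique∧set⇒bag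
      (Unique.map⁺ (Injection.injective (↔⇒↣ bijection)) (Unique.filter⁺ _ unique))
      (Unique.filter⁺ _ unique)
      (mk⇔ ⊆ˡ ⊆ʳ))
      where
      ⊆ˡ : map to N[ v ] ⊆ N[ to v ]
      ⊆ˡ x∈ with _ , u∈ , refl ← ∈-map⁻ to x∈ =
        ∈-filter⁺ (_∈N?[ to v ]) (complete _)
          (∈N-to (∈-filter⁻ (_∈N?[ v ]) {xs = vertices} u∈ .proj₂))
      ⊆ʳ : N[ to v ] ⊆ map to N[ v ]
      ⊆ʳ {x} x∈ = subst (_∈ _) (strictlyInverseˡ x)
        (∈-map⁺ to (∈-filter⁺ (_∈N?[ v ]) (complete _)
          (∈N-to⁻ (subst (_∈N[ to v ]) (sym (strictlyInverseˡ x))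
            (∈-filter⁻ (_∈N?[ to v ]) {xs = vertices} x∈ .proj₂)))))

    module _ (P Q : Position) (P≗Q : P ≗ Q ∘ to) where

      weight-to : ∀ v → weight P v ≡ weight Q (to v)
      weight-to v = cong (if_then 0 else 1) (P≗Q v)

      σ-to : ∀ v → σ P v ≡ σ Q (to v)
      σ-to v = begin
        sum (map (weight P) N[ v ])             ≡⟨ cong sum (map-cong weight-to N[ v ]) ⟩
        sum (map (weight Q ∘ to) N[ v ])        ≡⟨ cong sum (map-∘ N[ v ]) ⟩
        sum (map (weight Q) (map to N[ v ]))    ≡⟨ sum-↭ (↭.map⁺ (weight Q) (N-to v)) ⟩
        sum (map (weight Q) N[ to v ])          ∎
        where open ≡-Reasoning

      -- Positions are functions, so they are related by pointwise equality, which avoids function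
      -- extensionality.
      toggle-to : ∀ v → toggle P v ≗ toggle Q (to v) ∘ to
      toggle-to v u = cong₂ (λ b w → if b then not w else w)
        (does-⇔ (mk⇔ ∈N-to ∈N-to⁻) (u ∈N?[ v ]) (to u ∈N?[ to v ])) (P≗Q u)

    legal-to : ∀ P Q → P ≗ Q ∘ to → ∀ {v} → Legal P v → Legal Q (to v)
    legal-to P Q P≗Q {v} (w≡1 , σ<) =
      trans (sym (weight-to P Q P≗Q v)) w≡1 ,
      subst₂ _<_ (σ-to (toggle P v) (toggle Q (to v)) (toggle-to P Q P≗Q v) v) (σ-to P Q P≗Q v) σ<

    options-to : ∀ P Q → P ≗ Q ∘ to →
                 ∀ {P′} → P′ ∈ options P → ∃[ Q′ ] Q′ ∈ options Q × P′ ≗ Q′ ∘ to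
    options-to P Q P≗Q P′∈ with v , v∈ , refl ← ∈-map⁻ (toggle P) P′∈ =
      toggle Q (to v) ,
      ∈-map⁺ (toggle Q) (∈-filter⁺ (legal? Q) (complete _)
        (legal-to P Q P≗Q (∈-filter⁻ (legal? P) {xs = vertices} v∈ .proj₂))) ,
      toggle-to P Q P≗Q v

  module _ (α : Automorphism G) where
    open Automorphism α

    -- Obtained from `options-to` for the inverse automorphism, with the roles of `P` and `Q`
    -- exchanged.
    options-to⁻ : ∀ P Q → P ≗ Q ∘ to →
                  ∀ {Q′} → Q′ ∈ options Q → ∃[ P′ ] P′ ∈ options P × P′ ≗ Q′ ∘ to
    options-to⁻ P Q P≗Q Q′∈
      with P′ , P′∈ , Q′≗P′ ← options-to (inverse α) Q P
             (λ v → sym (trans (P≗Q (from v)) (cong Q (strictlyInverseˡ v)))) Q′∈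
      = P′ , P′∈ , λ v → sym (trans (Q′≗P′ (to v)) (cong P′ (strictlyInverseʳ v)))

  -- Working with an arbitrary Grundy function keeps conversion checking from
  -- unfolding the well-founded recursion behind 𝒢.
  IsGrundy : (Position → ℕ) → Set
  IsGrundy g = ∀ P → IsMex (map g (options P)) (g P)

  𝒢-isGrundy : IsGrundy 𝒢
  𝒢-isGrundy P = subst (IsMex (map 𝒢 (options P))) (sym (𝒢-unfold P))
    (proj₂ (mex-exists (map 𝒢 (options P))))

  -- Invariance and bounds for Grundy values

  module _ (g : Position → ℕ) (g-isGrundy : IsGrundy g) where

    -- Induction along the moves from `P`: the automorphism matches the options of `P` and `Q` in
    -- both directions, and matched options have equal values. `Q` varies in the recursion, as each
    -- option has its own partner.
    grundy-to : ∀ (α : Automorphism G) P Q → P ≗ Q ∘ Automorphism.to α → g P ≡ g Q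
    grundy-to α P = go P (≺-wellFounded P)
      where
      open Automorphism α
      go : ∀ P → Acc _≺_ P → ∀ Q → P ≗ Q ∘ to → g P ≡ g Q
      go P (acc rs) Q P≗Q = IsMex-unique P⊆Q Q⊆P (g-isGrundy P) (g-isGrundy Q)
        where
        P⊆Q : map g (options P) ⊆ map g (options Q)
        P⊆Q = map-⊆-map⁺ λ {P′} P′∈ → let Q′ , Q′∈ , P′≗Q′ = options-to α P Q P≗Q P′∈ in
          Q′ , Q′∈ , go P′ (rs P′∈) Q′ P′≗Q′
        Q⊆P : map g (options Q) ⊆ map g (options P)
        Q⊆P = map-⊆-map⁺ λ {Q′} Q′∈ → let P′ , P′∈ , P′≗Q′ = options-to⁻ α P Q P≗Q Q′∈ in
          P′ , P′∈ , sym (go P′ (rs P′∈) Q′ P′≗Q′)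

    -- A legal move is made at a vertex of weight 1, so `L` covers the values of all options. For a
    -- concrete `L` the `upTo` list computes to the explicit lists of the theorem.
    grundy-bound : ∀ P L → (∀ v → weight P v ≡ 1 → g (toggle P v) ∈ L) →
                   g P ∈ upTo (suc (length L))
    grundy-bound P L values∈L = ∈-upTo⁺ (s≤s (IsMex⇒≤length L ⊆L (g-isGrundy P)))
      where
      ⊆L : map g (options P) ⊆ L
      ⊆L = map-⊆⁺ λ P′∈ → let v , v∈ , P′≡ = ∈-map⁻ (toggle P) P′∈ in
        subst (λ P′ → g P′ ∈ L) (sym P′≡)
          (values∈L v (∈-filter⁻ (legal? P) {xs = vertices} v∈ .proj₂ .proj₁))

-- Arithmetic of indices modulo `m`

module _ {n : ℕ} where
  private m = suc n

  toℕ-⊕ : ∀ (i : Fin m) a → toℕ (i ⊕ a) ≡ (toℕ i + a) % m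
  toℕ-⊕ i a = Fin.toℕ-fromℕ< (m%n<n (toℕ i + a) m)

  ⊕-assoc : ∀ (i : Fin m) a b → (i ⊕ a) ⊕ b ≡ i ⊕ (a + b)
  ⊕-assoc i a b = Fin.toℕ-injective (begin
    toℕ ((i ⊕ a) ⊕ b)                        ≡⟨ toℕ-⊕ (i ⊕ a) b ⟩
    (toℕ (i ⊕ a) + b) % m                    ≡⟨ cong (λ x → (x + b) % m) (toℕ-⊕ i a) ⟩
    -- Distributing reduces the first summand a second time; the next step removes the repetition.
    ((toℕ i + a) % m + b) % m                ≡⟨ %-distribˡ-+ ((toℕ i + a) % m) b m ⟩
    ((toℕ i + a) % m % m + b % m) % m        ≡⟨ cong (λ x → (x + b % m) % m) (m%n%n≡m%n (toℕ i + a) m) ⟩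
    ((toℕ i + a) % m + b % m) % m            ≡⟨ %-distribˡ-+ (toℕ i + a) b m ⟨
    (toℕ i + a + b) % m                      ≡⟨ cong (_% m) (+-assoc (toℕ i) a b) ⟩
    (toℕ i + (a + b)) % m                    ≡⟨ toℕ-⊕ i (a + b) ⟨
    toℕ (i ⊕ (a + b))                        ∎)
    where open ≡-Reasoning

  ⊕-comm : ∀ (i : Fin m) a b → (i ⊕ a) ⊕ b ≡ (i ⊕ b) ⊕ a
  ⊕-comm i a b = begin
    (i ⊕ a) ⊕ b    ≡⟨ ⊕-assoc i a b ⟩
    i ⊕ (a + b)    ≡⟨ cong (i ⊕_) (+-comm a b) ⟩
    i ⊕ (b + a)    ≡⟨ ⊕-assoc i b a ⟨
    (i ⊕ b) ⊕ a    ∎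
    where open ≡-Reasoning

  ⊕-period : ∀ (i : Fin m) → i ⊕ m ≡ i
  ⊕-period i = Fin.toℕ-injective (begin
    toℕ (i ⊕ m)       ≡⟨ toℕ-⊕ i m ⟩
    (toℕ i + m) % m   ≡⟨ [m+n]%n≡m%n (toℕ i) m ⟩
    toℕ i % m         ≡⟨ m<n⇒m%n≡m (Fin.toℕ<n i) ⟩
    toℕ i             ∎)
    where open ≡-Reasoning

  -- The source of transitivity: a rotation carries index zero to any given index.
  zero-⊕ : ∀ (i : Fin m) → Fin.zero ⊕ toℕ i ≡ i
  zero-⊕ i = Fin.toℕ-injective (trans (toℕ-⊕ Fin.zero (toℕ i)) (m<n⇒m%n≡m (Fin.toℕ<n i)))

-- Rotations of the generalized Petersen graph

rotate : ∀ {m} → ℕ → Vertex m → Vertex m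
rotate t (inner i) = inner (i ⊕ t)
rotate t (outer i) = outer (i ⊕ t)

module _ {n : ℕ} where
  private m = suc n

  -- Index shifts commute, so the edge leaving the rotated source ends at the rotated target.
  rotate-edge : ∀ {k} t {x y : Vertex m} → Edge k x y → Edge k (rotate t x) (rotate t y)
  rotate-edge t (outerEdge i) =
    subst (Edge _ _) (cong outer (⊕-comm i t 1)) (outerEdge (i ⊕ t))
  rotate-edge {k} t (innerEdge i) =
    subst (Edge _ _) (cong inner (⊕-comm i t k)) (innerEdge (i ⊕ t))
  rotate-edge t (spoke i) = spoke (i ⊕ t)

  -- The two rotations add up to a full turn. The symmetric hypothesis serves both inverse laws of
  -- `rotation`.
  rotate-rotate : ∀ {s t} → s + t ≡ m → ∀ (v : Vertex m) → rotate t (rotate s v) ≡ v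
  rotate-rotate {s} {t} s+t≡m = λ where
      (inner i) → cong inner (turn i)
      (outer i) → cong outer (turn i)
    where
    turn : ∀ i → (i ⊕ s) ⊕ t ≡ i
    turn i = trans (⊕-assoc i s t) (trans (cong (i ⊕_) s+t≡m) (⊕-period i))

  module _ (k : ℕ) (0<k : 0 < k) (k≤ : k ≤ ⌊ n /2⌋) where
    private G = Petersen m k 0<k k≤
    open Toggle G

    rotation : ∀ {t} → t ≤ m → Automorphism G
    rotation {t} t≤m = record
      { bijection = mk↔ₛ′ (rotate t) (rotate (m ∸ t))
          (rotate-rotate (m∸n+n≡m t≤m)) (rotate-rotate (m+[n∸m]≡n t≤m))
      ; to-adj   = gmap (rotate t) (rotate-edge t)
      ; from-adj = gmap (rotate (m ∸ t)) (rotate-edge (m ∸ t))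
      }

    module _ (g : Position → ℕ) (g-isGrundy : IsGrundy G g) where

      module _ (P : Position) (P-invariant : ∀ t → P ≗ P ∘ rotate t) where

        -- The rotation fixes `P`, hence carries the result of playing `v` to that of playing
        -- `rotate t v`.
        grundy-toggle-rotate : ∀ {t} → t ≤ m → ∀ v → g (toggle P v) ≡ g (toggle P (rotate t v))
        grundy-toggle-rotate {t} t≤m v =
          grundy-to G g g-isGrundy (rotation t≤m) (toggle P v) (toggle P (rotate t v))
            (toggle-to G (rotation t≤m) P P (P-invariant t) v)

        grundy-toggle-inner : ∀ i → g (toggle P (inner i)) ≡ g (toggle P (inner Fin.zero))
        grundy-toggle-inner i = trans (cong (λ j → g (toggle P (inner j))) (sym (zero-⊕ i)))
          (sym (grundy-toggle-rotate (<⇒≤ (Fin.toℕ<n i)) (inner Fin.zero)))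

        grundy-toggle-outer : ∀ i → g (toggle P (outer i)) ≡ g (toggle P (outer Fin.zero))
        grundy-toggle-outer i = trans (cong (λ j → g (toggle P (outer j))) (sym (zero-⊕ i)))
          (sym (grundy-toggle-rotate (<⇒≤ (Fin.toℕ<n i)) (outer Fin.zero)))

      grundy-𝒫₁₁ : g (𝒫₁₁ m k 0<k k≤) ∈ 0 ∷ 1 ∷ 2 ∷ []
      grundy-𝒫₁₁ = grundy-bound G g g-isGrundy P
        (g (toggle P (inner Fin.zero)) ∷ g (toggle P (outer Fin.zero)) ∷ [])
        λ where
          (inner i) _ → here (grundy-toggle-inner P (λ _ _ → refl) i)
          (outer i) _ → there (here (grundy-toggle-outer P (λ _ _ → refl) i))
        where P = 𝒫₁₁ m k 0<k k≤

      grundy-𝒫₀₁ : g (𝒫₀₁ m k 0<k k≤) ∈ 0 ∷ 1 ∷ []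
      grundy-𝒫₀₁ = grundy-bound G g g-isGrundy P (g (toggle P (outer Fin.zero)) ∷ [])
        -- Inner vertices have weight 0 here, so their case is absurd. Invariance needs a case split
        -- because `rotate` and `P` compute only on constructors.
        λ { (outer i) _ → here (grundy-toggle-outer P
              (λ { _ (inner _) → refl ; _ (outer _) → refl }) i) }
        where P = 𝒫₀₁ m k 0<k k≤

      grundy-𝒫₁₀ : g (𝒫₁₀ m k 0<k k≤) ∈ 0 ∷ 1 ∷ []
      grundy-𝒫₁₀ = grundy-bound G g g-isGrundy P (g (toggle P (inner Fin.zero)) ∷ [])
        λ { (inner i) _ → here (grundy-toggle-inner P
              (λ { _ (inner _) → refl ; _ (outer _) → refl }) i) }
        where P = 𝒫₁₀ m k 0<k k≤

theorem4p6 : (m k : ℕ) (0<k : 0 < k) (k≤ : k ≤ ⌊ m ∸ 1 /2⌋) →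
    let open Toggle (Petersen m k 0<k k≤) in
    𝒢 (𝒫₁₁ m k 0<k k≤) ∈ 0 ∷ 1 ∷ 2 ∷ []
    × (𝒢 (𝒫₀₁ m k 0<k k≤) ∈ 0 ∷ 1 ∷ [] × 𝒢 (𝒫₁₀ m k 0<k k≤) ∈ 0 ∷ 1 ∷ [])
-- For `m = 0` the bounds read `0 < k ≤ 0`.
theorem4p6 zero k 0<k k≤ = contradiction (≤-trans 0<k k≤) λ ()
theorem4p6 m@(suc _) k 0<k k≤ =
  grundy-𝒫₁₁ k 0<k k≤ 𝒢 isGrundy ,
  grundy-𝒫₀₁ k 0<k k≤ 𝒢 isGrundy ,
  grundy-𝒫₁₀ k 0<k k≤ 𝒢 isGrundy
  where
  open Toggle (Petersen m k 0<k k≤)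
  isGrundy = 𝒢-isGrundy (Petersen m k 0<k k≤)
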